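{- Let $\alpha: A^* \to M$ be a morphism into a finite monoid $M$ and let $\rho: 2^{A^*} \to R$ be a multiplicative rating map. Then the $\Sigma_1$-optimal $\alpha$-pointed $\rho$-imprint $\mathcal{P}_{\Sigma_1}[\alpha,\rho]$ is the least (for inclusion) $\Sigma_1$-saturated subset of $M \times R$ (for $\alpha$ and $\rho$).
   Context: $A$ is a fixed finite alphabet; languages are subsets of $A^*$ and a class of languages is a set of languages over $A$. **The class $\Sigma_1$.** A word is viewed as a (possibly empty) linearly ordered sequence of positions labeled over $A$; first-order sentences use unary predicates $P_a$ ($a\in A$) and the strict order $<$. A $\Sigma_1$ sentence is one whose prenex normal form has only existential quantifiers (a single block of existential quantifiers, or no quantifier). $\Sigma_1$ also denotes the class of languages over $A$ definable by such sentences. **Multiplicative rating maps.** Semirings have a commutative additive monoid $(R,+,0_R)$, a multiplicative monoid $(R,\cdot,1_R)$, multiplication distributes over addition, and $0_R$ is a zero for multiplication. A semiring is idempotent if $r+r=r$ for all $r$. It is ordered by $r\leq s$ iff $r+s=s$. A multiplicative rating map is a semiring morphism $\rho:(2^{A^*},\cup,\cdot)\to(R,+,\cdot)$ where $R$ is a finite idempotent semiring: $\rho(\emptyset)=0_R$, $\rho(K_1\cup K_2)=\rho(K_1)+\rho(K_2)$, $\rho(\{\varepsilon\})=1_R$, $\rho(K_1K_2)=\rho(K_1)\rho(K_2)$. Write $\rho(w)$ for $\rho(\{w\})$. **Imprints.** For a finite set $\mathbf{K}$ of languages, $\mathcal{I}[\rho](\mathbf{K})=\{r\in R\mid \exists K\in\mathbf{K},\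 r\leq\rho(K)\}$. A $\mathcal{C}$-cover of a language $L$ is a finite set $\mathbf{K}$ of languages of $\mathcal{C}$ with $L\subseteq\bigcup_{K\in\mathbf{K}}K$. It is optimal for $\rho$ if $\mathcal{I}[\rho](\mathbf{K})\subseteq\mathcal{I}[\rho](\mathbf{K}')$ for every $\mathcal{C}$-cover $\mathbf{K}'$ of $L$ (one always exists when $\mathcal{C}$ contains $\emptyset, A^*$ and is closed under union and intersection). $\mathcal{I}_{\mathcal{C}}[L,\rho]$ is $\mathcal{I}[\rho](\mathbf{K})$ for any optimal $\mathcal{C}$-cover $\mathbf{K}$ of $L$ for $\rho$. The $\mathcal{C}$-optimal $\alpha$-pointed $\rho$-imprint is $\mathcal{P}_{\mathcal{C}}[\alpha,\rho]=\{(s,r)\in M\times R\mid r\in\mathcal{I}_{\mathcal{C}}[\alpha^{ -1}(s),\rho]\}$. **Saturation.** Let $\mathcal{P}_{triv}[\alpha,\rho]=\{(s,r)\in M\times R\mid \exists w\in\alpha^{ -1}(s),\ r\leq\rho(w)\}$. A set $S\subseteq M\times R$ is $\Sigma_1$-saturated if it contains $\mathcal{P}_{triv}[\alpha,\rho]$ and: (1) if $(s,r)\in S$ and $r'\leq r$ then $(s,r')\in S$; (2) if $(s,q),(t,r)\in S$ then $(st,qr)\in S$; (3) $(1_M,\rho(A^*))\in S$. -}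

module Defs where

open import Algebra.Bundles using (Monoid; IdempotentSemiring; RawSemiring)
open import Algebra.Morphism.Structures
  using (module MonoidMorphisms; module SemiringMorphisms)
open import Data.Empty using (⊥)
open import Data.Fin.Base as Fin using (Fin)
open import Data.List.Base
  using (List; []; _++_; length; lookup; ++-[]-rawMonoid)
open import Data.List.Relation.Unary.All using (All)
open import Data.List.Relation.Unary.Any using (Any)
open import Data.Nat.Base using (ℕ; zero; suc)
open import Data.Product.Base using (Σ-syntax; ∃-syntax; _×_; _,_)
open import Data.Sum.Base using (_⊎_)
open import Data.Unit.Base using (⊤)
open import Data.Vec.Base as Vec using (Vec; []; _∷_)
open import Function.Bundles using (Inverse)
open import Level using (Level; 0ℓ; _⊔_) renaming (suc to lsuc)
open import Relation.Binary.Bundles using (Setoid)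
open import Relation.Binary.PropositionalEquality as ≡ using (_≡_)
open import Relation.Nullary.Negation.Core using (¬_)
open import Relation.Unary using (Pred; _∈_; _⊆_; _∪_; _≐_; ∅; U; ｛_｝)

private
  variable
    a ℓ c m ℓm r ℓr : Level

Finite : Setoid a ℓ → Set (a ⊔ ℓ)
Finite S = ∃[ n ] Inverse (≡.setoid (Fin n)) S

Language : Set → Set₁
Language A = Pred (List A) 0ℓ

infixl 7 _·_

_·_ : {A : Set} → Language A → Language A → Language A
(K · L) w = ∃[ u ] ∃[ v ] (u ∈ K × v ∈ L × w ≡ u ++ v)

languageRawSemiring : Set → RawSemiring (lsuc 0ℓ) 0ℓ
languageRawSemiring A = record
  { Carrier = Language A
  ; _≈_     = _≐_
  ; _+_     = _∪_
  ; _*_     = _·_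
  ; 0#      = ∅
  ; 1#      = ｛ [] ｝
  }

-- Formula A n: formulas whose free variables are de Bruijn indices in Fin n.
data Formula (A : Set) (n : ℕ) : Set where
  true false : Formula A n
  P          : A → Fin n → Formula A n
  _≺_        : Fin n → Fin n → Formula A n
  not        : Formula A n → Formula A n
  _and_ _or_ : Formula A n → Formula A n → Formula A n
  ex all     : Formula A (suc n) → Formula A n

Sentence : Set → Set
Sentence A = Formula A zero

_,_⊨_ : {A : Set} {n : ℕ} (w : List A) → Vec (Fin (length w)) n → Formula A n → Set
w , xs ⊨ true      = ⊤
w , xs ⊨ false     = ⊥
w , xs ⊨ P b i     = lookup w (Vec.lookup xs i) ≡ b
w , xs ⊨ (i ≺ j)   = Vec.lookup xs i Fin.< Vec.lookup xs j
w , xs ⊨ not φ     = ¬ (w , xs ⊨ φ)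
w , xs ⊨ (φ and ψ) = (w , xs ⊨ φ) × (w , xs ⊨ ψ)
w , xs ⊨ (φ or ψ)  = (w , xs ⊨ φ) ⊎ (w , xs ⊨ ψ)
w , xs ⊨ ex φ      = Σ[ x ∈ Fin (length w) ] (w , (x ∷ xs) ⊨ φ)
w , xs ⊨ all φ     = (x : Fin (length w)) → w , (x ∷ xs) ⊨ φ

⟦_⟧ : {A : Set} → Sentence A → Language A
⟦ φ ⟧ w = w , [] ⊨ φ

data QuantifierFree {A : Set} {n : ℕ} : Formula A n → Set where
  true  : QuantifierFree true
  false : QuantifierFree false
  P     : ∀ b i → QuantifierFree (P b i)
  _≺_   : ∀ i j → QuantifierFree (i ≺ j)
  not   : ∀ {φ} → QuantifierFree φ → QuantifierFree (not φ)
  _and_ : ∀ {φ ψ} → QuantifierFree φ → QuantifierFree ψ → QuantifierFree (φ and ψ)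
  _or_  : ∀ {φ ψ} → QuantifierFree φ → QuantifierFree ψ → QuantifierFree (φ or ψ)

-- Prenex form is taken literally, since moving quantifiers outwards is not
-- sound on the empty word.  The constants true and false provide the
-- quantifier-free sentences.
data IsΣ₁ {A : Set} {n : ℕ} : Formula A n → Set where
  matrix : ∀ {φ} → QuantifierFree φ → IsΣ₁ φ
  ex     : ∀ {φ} → IsΣ₁ φ → IsΣ₁ (ex φ)

Σ₁ : (A : Set) → Pred (Language A) 0ℓ
Σ₁ A L = Σ[ φ ∈ Sentence A ] (IsΣ₁ φ × L ≐ ⟦ φ ⟧)

-- The covered language may live in any universe, so that preimages under
-- morphisms into a monoid with a large equality are allowed.
record IsCover {A : Set} (𝒞 : Pred (Language A) c) (L : Pred (List A) ℓ)
               (𝐊 : List (Language A)) : Set (lsuc 0ℓ ⊔ c ⊔ ℓ) where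
  field
    in𝒞    : All 𝒞 𝐊
    covers : ∀ {w} → w ∈ L → Any (w ∈_) 𝐊

IsMultiplicativeRatingMap : (A : Set) (R : IdempotentSemiring r ℓr) →
  (Language A → IdempotentSemiring.Carrier R) → Set (lsuc 0ℓ ⊔ r ⊔ ℓr)
IsMultiplicativeRatingMap A R ρ =
  Finite R.setoid × IsSemiringHomomorphism ρ
  where
  module R = IdempotentSemiring R
  open SemiringMorphisms (languageRawSemiring A) R.rawSemiring

module Imprint {A : Set} (R : IdempotentSemiring r ℓr)
               (ρ : Language A → IdempotentSemiring.Carrier R) where

  open IdempotentSemiring R

  infix 4 _≤_

  _≤_ : Carrier → Carrier → Set ℓr
  q ≤ q′ = q + q′ ≈ q′

  ℐ[_] : List (Language A) → Pred Carrier (lsuc 0ℓ ⊔ ℓr)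
  ℐ[ 𝐊 ] q = Any (λ K → q ≤ ρ K) 𝐊

  record IsOptimalCover (𝒞 : Pred (Language A) c) (L : Pred (List A) ℓ)
                        (𝐊 : List (Language A)) :
                        Set (lsuc 0ℓ ⊔ c ⊔ ℓ ⊔ r ⊔ ℓr) where
    field
      isCover : IsCover 𝒞 L 𝐊
      optimal : ∀ 𝐊′ → IsCover 𝒞 L 𝐊′ → ℐ[ 𝐊 ] ⊆ ℐ[ 𝐊′ ]

  -- All optimal covers have the same imprint, so this is the imprint of any
  -- one of them.
  OptimalImprint : (𝒞 : Pred (Language A) c) (L : Pred (List A) ℓ) →
                   Pred Carrier (lsuc 0ℓ ⊔ c ⊔ ℓ ⊔ r ⊔ ℓr)
  OptimalImprint 𝒞 L q = ∃[ 𝐊 ] (IsOptimalCover 𝒞 L 𝐊 × q ∈ ℐ[ 𝐊 ])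

IsWordMorphism : (A : Set) (M : Monoid m ℓm) →
                 (List A → Monoid.Carrier M) → Set ℓm
IsWordMorphism A M α = IsMonoidHomomorphism α
  where open MonoidMorphisms (++-[]-rawMonoid A) (Monoid.rawMonoid M)

module Pointed {A : Set} (M : Monoid m ℓm) (R : IdempotentSemiring r ℓr)
               (α : List A → Monoid.Carrier M)
               (ρ : Language A → IdempotentSemiring.Carrier R) where

  private
    module M = Monoid M
    module R = IdempotentSemiring R

  open Imprint R ρ

  preimage : M.Carrier → Pred (List A) ℓm
  preimage s w = α w M.≈ s

  𝒫[_] : Pred (Language A) c →
         Pred (M.Carrier × R.Carrier) (lsuc 0ℓ ⊔ c ⊔ ℓm ⊔ r ⊔ ℓr)
  𝒫[ 𝒞 ] (s , q) = q ∈ OptimalImprint 𝒞 (preimage s)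

  𝒫-triv : Pred (M.Carrier × R.Carrier) (ℓm ⊔ ℓr)
  𝒫-triv (s , q) = ∃[ w ] (w ∈ preimage s × q ≤ ρ ｛ w ｝)

  -- The field resp says that S is a subset of the setoid M × R; invariance in
  -- the second component already follows from downward closure.
  record IsΣ₁Saturated (S : Pred (M.Carrier × R.Carrier) ℓ) :
                       Set (m ⊔ ℓm ⊔ r ⊔ ℓr ⊔ ℓ) where
    field
      resp     : ∀ {s s′ q q′} → s M.≈ s′ → q R.≈ q′ → (s , q) ∈ S → (s′ , q′) ∈ S
      trivial  : 𝒫-triv ⊆ S
      downward : ∀ {s q q′} → (s , q) ∈ S → q′ ≤ q → (s , q′) ∈ S
      mult     : ∀ {s t q q′} → (s , q) ∈ S → (t , q′) ∈ S →
                 (s M.∙ t , q R.* q′) ∈ S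
      full     : (M.ε , ρ U) ∈ S

{-# OPTIONS --safe #-}

-- For a word w let ↑w be the language of words containing w as a scattered
-- subword.  A Σ₁ language containing w contains ↑w, and each ↑w is Σ₁.
-- Deleting an infix between two prefixes with equal image under α does not
-- change α, so every word of α⁻¹(s) has a subword in α⁻¹(s) of length at most
-- |M|.  Hence the languages ↑w with α(w) = s and |w| ≤ |M| form an optimal
-- Σ₁-cover of α⁻¹(s), and (s , q) lies in the pointed imprint if and only if
-- q ≤ ρ(↑w) for some w with α(w) = s.  Saturation is read off this description.
-- Leastness holds because ↑(a₁⋯aₙ) = A* a₁ A* ⋯ aₙ A*, so that (α(w) , ρ(↑w))
-- is a product of pairs (1 , ρ(A*)) and (α(a) , ρ(a)).
module Submission where

open import Defs
open import Algebra.Bundles using (Monoid; IdempotentSemiring)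
open import Algebra.Morphism.Structures
  using (module MonoidMorphisms; module SemiringMorphisms)
open import Data.Fin.Base as Fin using (Fin; zero; suc; toℕ)
open import Data.Fin.Properties as Fin using (pigeonhole; toℕ<n)
open import Data.List.Base as List
  using (List; []; _∷_; _++_; [_]; length; lookup; take; drop; filter;
         cartesianProductWith; ++-[]-rawMonoid)
open import Data.List.Membership.Propositional
  using (find; lose) renaming (_∈_ to _∈ˡ_)
open import Data.List.Membership.Propositional.Properties
  using (∈-allFin; ∈-map⁺; ∈-cartesianProductWith⁺; ∈-filter⁺)
open import Data.List.Properties
  using (length-++; length-take; length-drop; take++drop≡id)
open import Data.List.Relation.Binary.Sublist.Propositional
  using ([]; _∷_; _∷ʳ_; ⊆-refl; ⊆-trans; minimum) renaming (_⊆_ to _⊑_)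
open import Data.List.Relation.Binary.Sublist.Propositional.Properties
  using (++⁺; drop⁺-≥)
open import Data.List.Relation.Unary.All as All using ()
open import Data.List.Relation.Unary.All.Properties as All using (all-filter)
open import Data.List.Relation.Unary.Any as Any using (Any; here; there)
open import Data.List.Relation.Unary.Any.Properties as Any using ()
open import Data.Nat.Base as ℕ using (ℕ; zero; suc; z≤n; s≤s)
open import Data.Nat.Properties as ℕ using ()
open import Data.Product.Base using (_×_; _,_; ∃-syntax; proj₁; proj₂)
open import Data.Sum.Base using (inj₁; inj₂)
open import Data.Unit.Base using (tt)
open import Data.Vec.Base as Vec using (Vec; []; _∷_)
open import Data.Vec.Properties using (lookup-map; lookup∘tabulate)
open import Function.Base using (id; _∘_)
open import Function.Bundles using (Inverse; _⇔_; mk⇔; module Equivalence)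
open import Level using (Level)
open import Relation.Binary.Definitions using (Decidable; tri<; tri≈; tri>)
open import Relation.Binary.PropositionalEquality
  using (setoid; _≡_; refl; sym; trans; cong; cong₂; subst; subst₂)
open import Relation.Nullary.Decidable using (yes; no; map′)
open import Relation.Nullary.Negation using (contradiction)
open import Relation.Unary using (Pred; _⊆_; _∈_; U; ｛_｝)

private
  variable
    A : Set
    n k : ℕ
    v w : List A
    m ℓm r ℓr ℓ : Level

-- Scattered subwords as embeddings of labelled positions.

↑_ : List A → Language A
(↑ w) v = w ⊑ v

-- The model-theoretic form of `w ⊑ v`: formulas see positions, their order and their labels,
-- whereas `⊑` suits induction and concatenation.
record Embedding {A : Set} (w v : List A) : Set where
  field
    pos  : Fin (length w) → Fin (length v)
    mono : ∀ {i j} → i Fin.< j → pos i Fin.< pos j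
    lab  : ∀ i → lookup v (pos i) ≡ lookup w i

  reflect : ∀ {i j} → pos i Fin.< pos j → i Fin.< j
  reflect {i} {j} p with Fin.<-cmp i j
  ... | tri< i<j _ _ = i<j
  ... | tri≈ _ i≡j _ = contradiction (cong pos i≡j) (Fin.<⇒≢ p)
  ... | tri> _ _ j<i = contradiction (mono j<i) (ℕ.<-asym p)

⊑⇒embedding : w ⊑ v → Embedding w v
⊑⇒embedding [] = record { pos = λ () ; mono = λ { {()} } ; lab = λ () }
⊑⇒embedding (y ∷ʳ p) = record { pos = suc ∘ pos ; mono = s≤s ∘ mono ; lab = lab }
  where open Embedding (⊑⇒embedding p)
⊑⇒embedding {w = x ∷ w} {v = y ∷ v} (refl ∷ p) = record
  { pos = pos′ ; mono = mono′ ; lab = λ { zero → refl ; (suc i) → lab i } }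
  where
  open Embedding (⊑⇒embedding p)
  pos′ : Fin (suc (length w)) → Fin (suc (length v))
  pos′ zero    = zero
  pos′ (suc i) = suc (pos i)
  mono′ : ∀ {i j} → i Fin.< j → pos′ i Fin.< pos′ j
  mono′ {zero}  {suc j} _       = s≤s z≤n
  mono′ {suc i} {suc j} (s≤s q) = s≤s (mono q)

predecessor : {i j : Fin (suc n)} → i Fin.< j → ∃[ j′ ] j ≡ suc j′
predecessor {j = suc j} _ = j , refl

-- Lets the induction in `embedding⇒⊑` discard the first letter of the target once no position is
-- sent to it.
strip : ∀ {y : A} (e : Embedding w (y ∷ v)) → let open Embedding e in
        (∀ i → ∃[ j ] pos i ≡ suc j) → Embedding w v
strip {v = v} {y = y} e suc-pos = record
  { pos  = proj₁ ∘ suc-pos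
  ; mono = λ {i} {j} i<j →
      ℕ.s<s⁻¹ (subst₂ Fin._<_ (proj₂ (suc-pos i)) (proj₂ (suc-pos j)) (mono i<j))
  ; lab  = λ i → trans (cong (lookup (y ∷ v)) (sym (proj₂ (suc-pos i)))) (lab i)
  }
  where open Embedding e

embedding-tail : ∀ {x : A} → Embedding (x ∷ w) v → Embedding w v
embedding-tail e = record { pos = pos ∘ suc ; mono = mono ∘ s≤s ; lab = lab ∘ suc }
  where open Embedding e

-- If the first position is sent to `zero`, then `x` is matched with `y` and all later positions go
-- strictly above `zero`. Otherwise monotonicity keeps every image away from `zero`, and `y` is
-- skipped.
embedding⇒⊑ : ∀ (w v : List A) → Embedding w v → w ⊑ v
embedding⇒⊑ []      v       e = minimum v
embedding⇒⊑ (x ∷ w) []      e with () ← Embedding.pos e zero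
embedding⇒⊑ (x ∷ w) (y ∷ v) e = by-first (pos zero) refl
  where
  open Embedding e
  by-first : ∀ i → pos zero ≡ i → x ∷ w ⊑ y ∷ v
  by-first zero    eq =
    trans (sym (lab zero)) (cong (lookup (y ∷ v)) eq)
    ∷ embedding⇒⊑ w v (strip (embedding-tail e) (λ i → predecessor (mono {zero} (s≤s z≤n))))
  by-first (suc i) eq = y ∷ʳ embedding⇒⊑ (x ∷ w) v (strip e λ
    { zero    → i , eq
    ; (suc j) → predecessor (mono {zero} (s≤s z≤n)) })

-- Σ₁ languages are closed under superwords

module _ {w v : List A} (e : Embedding w v) where

  open Embedding e

  private
    variable
      xs : Vec (Fin (length w)) n
      φ  : Formula A n

  -- An equivalence, because negation exchanges the two directions; the atom `≺` then calls for
  -- `reflect` as well as `mono`.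
  QF-invariant : QuantifierFree φ → (w , xs ⊨ φ) ⇔ (v , Vec.map pos xs ⊨ φ)
  QF-invariant true  = mk⇔ id id
  QF-invariant false = mk⇔ id id
  QF-invariant {xs = xs} (P b i) = mk⇔ (trans eq) (trans (sym eq))
    where
    eq : lookup v (Vec.lookup (Vec.map pos xs) i) ≡ lookup w (Vec.lookup xs i)
    eq rewrite lookup-map i pos xs = lab (Vec.lookup xs i)
  QF-invariant {xs = xs} (i ≺ j)
    rewrite lookup-map i pos xs | lookup-map j pos xs = mk⇔ mono reflect
  QF-invariant (not q) = mk⇔ (_∘ from) (_∘ to)
    where open Equivalence (QF-invariant q)
  QF-invariant (q and q′) =
    mk⇔ (λ (s , t) → E.to s , E′.to t) (λ (s , t) → E.from s , E′.from t)
    where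
    module E  = Equivalence (QF-invariant q)
    module E′ = Equivalence (QF-invariant q′)
  QF-invariant (q or q′) =
    mk⇔ (λ { (inj₁ s) → inj₁ (E.to s) ; (inj₂ t) → inj₂ (E′.to t) })
        (λ { (inj₁ s) → inj₁ (E.from s) ; (inj₂ t) → inj₂ (E′.from t) })
    where
    module E  = Equivalence (QF-invariant q)
    module E′ = Equivalence (QF-invariant q′)

  -- Witnesses are transported along `pos`. The converse fails in general, since a witness in `v`
  -- may lie outside the image of `pos`.
  IsΣ₁-preserved : IsΣ₁ φ → w , xs ⊨ φ → v , Vec.map pos xs ⊨ φ
  IsΣ₁-preserved (matrix q) s       = Equivalence.to (QF-invariant q) s
  IsΣ₁-preserved (ex σ)     (x , s) = pos x , IsΣ₁-preserved σ s

Σ₁-upward : ∀ {K : Language A} → K ∈ Σ₁ A → w ∈ K → ↑ w ⊆ K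
Σ₁-upward (φ , σ , K⊆φ , φ⊆K) w∈K w⊑v =
  φ⊆K (IsΣ₁-preserved (⊑⇒embedding w⊑v) σ (K⊆φ w∈K))

-- The languages ↑w are Σ₁

⋀ : (Fin k → Formula A n) → Formula A n
⋀ {k = zero}  f = true
⋀ {k = suc k} f = f zero and ⋀ (f ∘ suc)

⋀-QF : {f : Fin k → Formula A n} → (∀ i → QuantifierFree (f i)) → QuantifierFree (⋀ f)
⋀-QF {k = zero}  q = true
⋀-QF {k = suc k} q = q zero and ⋀-QF (q ∘ suc)

⋀-intro : {f : Fin k → Formula A n} {xs : Vec (Fin (length w)) n} →
          (∀ i → w , xs ⊨ f i) → w , xs ⊨ ⋀ f
⋀-intro {k = zero}  s = tt
⋀-intro {k = suc k} s = s zero , ⋀-intro (s ∘ suc)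

⋀-elim : {f : Fin k → Formula A n} {xs : Vec (Fin (length w)) n} →
         w , xs ⊨ ⋀ f → ∀ i → w , xs ⊨ f i
⋀-elim (s , _) zero    = s
⋀-elim (_ , s) (suc i) = ⋀-elim s i

exs : Formula A n → Sentence A
exs {n = zero}  φ = φ
exs {n = suc n} φ = exs (ex φ)

exs-IsΣ₁ : {φ : Formula A n} → IsΣ₁ φ → IsΣ₁ (exs φ)
exs-IsΣ₁ {n = zero}  σ = σ
exs-IsΣ₁ {n = suc n} σ = exs-IsΣ₁ (ex σ)

exs-intro : {φ : Formula A n} (xs : Vec (Fin (length w)) n) → w , xs ⊨ φ → w ∈ ⟦ exs φ ⟧
exs-intro []       s = s
exs-intro (x ∷ xs) s = exs-intro xs (x , s)

exs-elim : (φ : Formula A n) → w ∈ ⟦ exs φ ⟧ → ∃[ xs ] (w , xs ⊨ φ)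
exs-elim {n = zero}  φ s = [] , s
exs-elim {n = suc n} φ s with exs-elim (ex φ) s
... | xs , x , t = x ∷ xs , t

-- The default `true` allows the order condition to be a conjunction over all pairs of indices.
increasing : Fin n → Fin n → Formula A n
increasing i j with i Fin.<? j
... | yes _ = i ≺ j
... | no  _ = true

-- Variable `i` stands for the position matched with the `i`-th letter of `w`, so that a satisfying
-- valuation in `v` amounts to an `Embedding w v`.
occurrence : (w : List A) → Formula A (length w)
occurrence w = ⋀ (λ i → P (lookup w i) i) and ⋀ (λ i → ⋀ (increasing i))

increasing-QF : ∀ (i j : Fin n) → QuantifierFree (increasing {A = A} i j)
increasing-QF i j with i Fin.<? j
... | yes _ = i ≺ j
... | no  _ = true

occurrence-QF : (w : List A) → QuantifierFree (occurrence w)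
occurrence-QF w = ⋀-QF (λ i → P (lookup w i) i) and ⋀-QF (λ i → ⋀-QF (increasing-QF i))

increasing-intro : ∀ {xs : Vec (Fin (length w)) n} i j →
  (i Fin.< j → Vec.lookup xs i Fin.< Vec.lookup xs j) → w , xs ⊨ increasing i j
increasing-intro i j s with i Fin.<? j
... | yes i<j = s i<j
... | no  _   = tt

increasing-elim : ∀ {xs : Vec (Fin (length w)) n} {i j} →
  w , xs ⊨ increasing i j → i Fin.< j → Vec.lookup xs i Fin.< Vec.lookup xs j
increasing-elim {i = i} {j = j} s i<j with i Fin.<? j
... | yes _   = s
... | no  i≮j = contradiction i<j i≮j

↑-Σ₁ : (w : List A) → ↑ w ∈ Σ₁ A
↑-Σ₁ w = exs (occurrence w) , exs-IsΣ₁ (matrix (occurrence-QF w)) , to , from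
  where
  to : ↑ w ⊆ ⟦ exs (occurrence w) ⟧
  to {v} w⊑v = exs-intro (Vec.tabulate pos)
    ( ⋀-intro (λ i → trans (cong (lookup v) (lookup∘tabulate pos i)) (lab i))
    , ⋀-intro (λ i → ⋀-intro (λ j → increasing-intro i j λ i<j →
        subst₂ Fin._<_ (sym (lookup∘tabulate pos i)) (sym (lookup∘tabulate pos j)) (mono i<j))))
    where open Embedding (⊑⇒embedding w⊑v)

  from : ⟦ exs (occurrence w) ⟧ ⊆ ↑ w
  from {v} s with exs-elim (occurrence w) s
  ... | xs , labels , order = embedding⇒⊑ w v record
    { pos  = Vec.lookup xs
    ; mono = λ {i} {j} → increasing-elim (⋀-elim (⋀-elim order i) j)
    ; lab  = ⋀-elim labels
    }

-- Upward closures and concatenation.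

↑-∷ : ∀ (x : A) w → ↑ (x ∷ w) ⊆ U · (｛ [ x ] ｝ · ↑ w)
↑-∷ x w (y ∷ʳ p) with ↑-∷ x w p
... | u , v , _ , v∈ , refl = y ∷ u , v , tt , v∈ , refl
↑-∷ x w {_ ∷ v} (refl ∷ p) = [] , x ∷ v , tt , ([ x ] , v , refl , p , refl) , refl

↑-++ : ∀ (u v : List A) → ↑ u · ↑ v ⊆ ↑ (u ++ v)
↑-++ u v (_ , _ , p , q , refl) = ++⁺ p q

-- Bounded representatives of the preimages of α

module _ (A-fin : Finite (setoid A)) where

  open Inverse (proj₂ A-fin) using (to; from; strictlyInverseˡ)

  letters : List A
  letters = List.map to (List.allFin (proj₁ A-fin))

  ∈-letters : ∀ x → x ∈ˡ letters
  ∈-letters x = subst (_∈ˡ letters) (strictlyInverseˡ x) (∈-map⁺ to (∈-allFin (from x)))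

  words : ℕ → List (List A)
  words zero    = [] ∷ []
  words (suc n) = [] ∷ cartesianProductWith _∷_ letters (words n)

  ∈-words : ∀ n (w : List A) → length w ℕ.≤ n → w ∈ˡ words n
  ∈-words zero    []      _         = here refl
  ∈-words (suc n) []      _         = here refl
  ∈-words (suc n) (x ∷ w) (s≤s w≤n) =
    there (∈-cartesianProductWith⁺ _∷_ (∈-letters x) (∈-words n w w≤n))

module _ (M : Monoid m ℓm) (M-fin : Finite (Monoid.setoid M))
         {α : List A → Monoid.Carrier M} (α-hom : IsWordMorphism A M α) where

  private module M = Monoid M
  open MonoidMorphisms (++-[]-rawMonoid A) M.rawMonoid
  open IsMonoidHomomorphism α-hom
  open Inverse (proj₂ M-fin) using (from; from-cong; strictlyInverseˡ; to)

  from-injective : ∀ {s t} → from s ≡ from t → s M.≈ t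
  from-injective {s} {t} eq =
    M.trans (M.sym (strictlyInverseˡ s))
            (M.trans (M.reflexive (cong to eq)) (strictlyInverseˡ t))

  M-≟ : Decidable M._≈_
  M-≟ s t = map′ from-injective from-cong (from s Fin.≟ from t)

  cut-shorter : ∀ (w : List A) {i j} → i ℕ.< j → j ℕ.≤ length w →
                length (take i w ++ drop j w) ℕ.< length w
  cut-shorter w {i} {j} i<j j≤ = begin-strict
    length (take i w ++ drop j w)            ≡⟨ length-++ (take i w) ⟩
    length (take i w) ℕ.+ length (drop j w)  ≡⟨ cong₂ ℕ._+_ (length-take i w) (length-drop j w) ⟩
    i ℕ.⊓ length w ℕ.+ (length w ℕ.∸ j)      ≤⟨ ℕ.+-monoˡ-≤ _ (ℕ.m⊓n≤m i _) ⟩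
    i ℕ.+ (length w ℕ.∸ j)                   <⟨ ℕ.+-monoˡ-< _ i<j ⟩
    j ℕ.+ (length w ℕ.∸ j)                   ≡⟨ ℕ.m+[n∸m]≡n j≤ ⟩
    length w                                 ∎
    where open ℕ.≤-Reasoning

  cut-same-image : ∀ (w : List A) i j → α (take i w) M.≈ α (take j w) →
                   α (take i w ++ drop j w) M.≈ α w
  cut-same-image w i j eq =
    M.trans (homo (take i w) (drop j w))
    (M.trans (M.∙-congʳ eq)
    (M.trans (M.sym (homo (take j w) (drop j w)))
             (M.reflexive (cong α (take++drop≡id j w)))))

  cut-⊑ : ∀ (w : List A) {i j} → i ℕ.< j → take i w ++ drop j w ⊑ w
  cut-⊑ w {i} {j} i<j = subst (take i w ++ drop j w ⊑_) (take++drop≡id i w)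
    (++⁺ (⊆-refl {x = take i w}) (drop⁺-≥ (ℕ.<⇒≤ i<j)))

  -- As long as the word is longer than the cardinality of `M`, two of its prefixes have the same
  -- image and the infix between them is cut out.
  short-subword : ∀ w → ∃[ w′ ] (w′ ⊑ w × α w′ M.≈ α w × length w′ ℕ.≤ proj₁ M-fin)
  short-subword w = bounded (length w) w ℕ.≤-refl
    where
    -- The bound `n` carries the recursion, as the shortened word is not a structural part of `w`.
    bounded : ∀ n w → length w ℕ.≤ n →
              ∃[ w′ ] (w′ ⊑ w × α w′ M.≈ α w × length w′ ℕ.≤ proj₁ M-fin)
    bounded n w w≤n with length w ℕ.≤? proj₁ M-fin
    ... | yes short = w , ⊆-refl , M.refl , short
    bounded zero    [] _   | no long = contradiction z≤n long
    bounded (suc n) w  w≤n | no long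
      -- The pigeons are the proper prefixes, of lengths `0` to `length w - 1`; their number
      -- `length w` already exceeds the cardinality of `M`.
      with i , j , i<j , eq ← pigeonhole (ℕ.≰⇒> long) (λ k → from (α (take (toℕ k) w)))
      with w′ , w′⊑ , α≈ , short ← bounded n (take (toℕ i) w ++ drop (toℕ j) w)
             (ℕ.s≤s⁻¹ (ℕ.≤-trans (cut-shorter w i<j (ℕ.<⇒≤ (toℕ<n j))) w≤n))
      = w′
      , ⊆-trans w′⊑ (cut-⊑ w i<j)
      , M.trans α≈ (cut-same-image w (toℕ i) (toℕ j) (from-injective eq))
      , short

-- The order of the semiring and monotonicity of rating maps.

module _ (R : IdempotentSemiring r ℓr)
         {ρ : Language A → IdempotentSemiring.Carrier R}
         (ρ-rating : IsMultiplicativeRatingMap A R ρ) where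

  open IdempotentSemiring R
    hiding (refl; setoid) renaming (sym to ≈-sym; trans to ≈-trans)
  open Imprint R ρ
  open SemiringMorphisms (languageRawSemiring A) rawSemiring
  open IsSemiringHomomorphism (proj₂ ρ-rating)

  ≤-trans : ∀ {p q s} → p ≤ q → q ≤ s → p ≤ s
  ≤-trans p≤q q≤s =
    ≈-trans (+-congˡ (≈-sym q≤s))
    (≈-trans (≈-sym (+-assoc _ _ _)) (≈-trans (+-congʳ p≤q) q≤s))

  ≈⇒≤ : ∀ {p q} → p ≈ q → p ≤ q
  ≈⇒≤ p≈q = ≈-trans (+-congʳ p≈q) (+-idem _)

  *-mono-≤ : ∀ {p q p′ q′} → p ≤ q → p′ ≤ q′ → p * p′ ≤ q * q′
  *-mono-≤ p≤q p′≤q′ = ≤-trans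
    (≈-trans (≈-sym (distribʳ _ _ _)) (*-congʳ p≤q))
    (≈-trans (≈-sym (distribˡ _ _ _)) (*-congˡ p′≤q′))

  -- Inclusion means `K ∪ L ≐ L`, which `ρ` turns into the equation defining `≤`.
  ρ-mono : ∀ {K L} → K ⊆ L → ρ K ≤ ρ L
  ρ-mono {K} {L} K⊆L = ≈-trans (≈-sym (+-homo K L))
    (⟦⟧-cong ((λ { (inj₁ x) → K⊆L x ; (inj₂ y) → y }) , inj₂))

  ρ↑-∷ : ∀ x w → ρ (↑ (x ∷ w)) ≤ ρ U * (ρ ｛ [ x ] ｝ * ρ (↑ w))
  ρ↑-∷ x w = ≤-trans (ρ-mono (↑-∷ x w))
    (≈⇒≤ (≈-trans (*-homo U (｛ [ x ] ｝ · ↑ w)) (*-congˡ (*-homo ｛ [ x ] ｝ (↑ w)))))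

  ρ↑-++ : ∀ u v → ρ (↑ u) * ρ (↑ v) ≤ ρ (↑ (u ++ v))
  ρ↑-++ u v = ≤-trans (≈⇒≤ (≈-sym (*-homo (↑ u) (↑ v)))) (ρ-mono (↑-++ u v))

-- Optimal covers of the preimages under `α`.

module _ (A-fin : Finite (setoid A))
         (M : Monoid m ℓm) (M-fin : Finite (Monoid.setoid M))
         {α : List A → Monoid.Carrier M} (α-hom : IsWordMorphism A M α)
         (R : IdempotentSemiring r ℓr)
         {ρ : Language A → IdempotentSemiring.Carrier R}
         (ρ-rating : IsMultiplicativeRatingMap A R ρ) where

  private
    module M = Monoid M
    module R = IdempotentSemiring R
  open Imprint R ρ
  open Pointed M R α ρ
  open MonoidMorphisms (++-[]-rawMonoid A) M.rawMonoid
  open IsMonoidHomomorphism α-hom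

  -- A description of `𝒫[ Σ₁ A ]` free of covers. The length of `w` is unbounded, so that
  -- concatenation of witnesses gives closure under products.
  UpwardImprint : Pred (M.Carrier × R.Carrier) _
  UpwardImprint (s , q) = ∃[ w ] (w ∈ preimage s × q ≤ ρ (↑ w))

  -- The length bound `proj₁ M-fin` is the cardinality of `M`, as provided by `short-subword`.
  representatives : M.Carrier → List (List A)
  representatives s = filter (λ w → M-≟ M M-fin α-hom (α w) s) (words A-fin (proj₁ M-fin))

  upwardCover : M.Carrier → List (Language A)
  upwardCover s = List.map ↑_ (representatives s)

  upwardCover-covers : ∀ {s w} → w ∈ preimage s → Any (w ∈_) (upwardCover s)
  upwardCover-covers {s} {w} α≈s
    with w′ , w′⊑w , α′≈ , short ← short-subword M M-fin α-hom w
    = Any.map⁺ (Any.map (λ { refl → w′⊑w })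
        (∈-filter⁺ (λ w → M-≟ M M-fin α-hom (α w) s) (∈-words A-fin _ w′ short)
                   (M.trans α′≈ α≈s)))

  upwardCover-isCover : ∀ s → IsCover (Σ₁ A) (preimage s) (upwardCover s)
  upwardCover-isCover s = record
    { in𝒞    = All.map⁺ (All.universal ↑-Σ₁ (representatives s))
    ; covers = upwardCover-covers
    }

  upwardCover-imprint : ∀ {s q} → q ∈ ℐ[ upwardCover s ] → (s , q) ∈ UpwardImprint
  upwardCover-imprint {s} q∈ =
    All.lookupWith (λ {w} α≈s q≤ → w , α≈s , q≤)
      (all-filter (λ w → M-≟ M M-fin α-hom (α w) s) (words A-fin (proj₁ M-fin)))
      (Any.map⁻ q∈)

  -- The member of the cover that contains `w` is upward closed, hence contains `↑ w`, and `ρ` is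
  -- monotone. This is the lower bound behind optimality.
  cover-imprint : ∀ {s q 𝐊} → IsCover (Σ₁ A) (preimage s) 𝐊 →
                  (s , q) ∈ UpwardImprint → q ∈ ℐ[ 𝐊 ]
  cover-imprint cover (w , α≈s , q≤)
    with K , K∈𝐊 , w∈K ← find (IsCover.covers cover α≈s)
    = lose K∈𝐊 (≤-trans R ρ-rating q≤
        (ρ-mono R ρ-rating (Σ₁-upward (All.lookup (IsCover.in𝒞 cover) K∈𝐊) w∈K)))

  upwardCover-isOptimal : ∀ s → IsOptimalCover (Σ₁ A) (preimage s) (upwardCover s)
  upwardCover-isOptimal s = record
    { isCover = upwardCover-isCover s
    ; optimal = λ 𝐊 cover q∈ → cover-imprint cover (upwardCover-imprint q∈)
    }

  𝒫⊆UpwardImprint : 𝒫[ Σ₁ A ] ⊆ UpwardImprint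
  𝒫⊆UpwardImprint {s , q} (𝐊 , 𝐊-optimal , q∈) = upwardCover-imprint
    (IsOptimalCover.optimal 𝐊-optimal (upwardCover s) (upwardCover-isCover s) q∈)

  UpwardImprint⊆𝒫 : UpwardImprint ⊆ 𝒫[ Σ₁ A ]
  UpwardImprint⊆𝒫 {s , q} q∈ =
    upwardCover s , upwardCover-isOptimal s , cover-imprint (upwardCover-isCover s) q∈

  -- Saturation of the pointed imprint.

  UpwardImprint-saturated : IsΣ₁Saturated UpwardImprint
  UpwardImprint-saturated = record
    { resp     = λ s≈ q≈ (w , α≈ , q≤) →
                   w , M.trans α≈ s≈ , R.trans (R.+-congʳ (R.sym q≈)) q≤
    ; trivial  = λ (w , α≈ , q≤) →
                   w , α≈ , ≤-trans R ρ-rating q≤ (ρ-mono R ρ-rating λ { refl → ⊆-refl })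
    ; downward = λ (w , α≈ , q≤) q′≤q → w , α≈ , ≤-trans R ρ-rating q′≤q q≤
    ; mult     = λ (u , αu≈ , q≤) (v , αv≈ , q′≤) →
                   u ++ v , M.trans (homo u v) (M.∙-cong αu≈ αv≈) ,
                   ≤-trans R ρ-rating (*-mono-≤ R ρ-rating q≤ q′≤) (ρ↑-++ R ρ-rating u v)
    -- The witness is the empty word, a subword of every word.
    ; full     = [] , ε-homo , ρ-mono R ρ-rating (λ {v} _ → minimum v)
    }

  𝒫-saturated : IsΣ₁Saturated 𝒫[ Σ₁ A ]
  𝒫-saturated = record
    { resp     = λ s≈ q≈ → UpwardImprint⊆𝒫 ∘ Sat.resp s≈ q≈ ∘ 𝒫⊆UpwardImprint
    ; trivial  = UpwardImprint⊆𝒫 ∘ Sat.trivial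
    ; downward = λ p q′≤q → UpwardImprint⊆𝒫 (Sat.downward (𝒫⊆UpwardImprint p) q′≤q)
    ; mult     = λ p p′ → UpwardImprint⊆𝒫 (Sat.mult (𝒫⊆UpwardImprint p) (𝒫⊆UpwardImprint p′))
    ; full     = UpwardImprint⊆𝒫 Sat.full
    }
    where module Sat = IsΣ₁Saturated UpwardImprint-saturated

  -- Leastness among saturated sets.

  module _ {S : Pred (M.Carrier × R.Carrier) ℓ} (S-saturated : IsΣ₁Saturated S) where

    open IsΣ₁Saturated S-saturated

    -- Induction on `w`: each letter contributes one factor from `full` and one from `trivial`, and
    -- `downward` needs only the inclusion `↑-∷`.
    ρ↑∈saturated : ∀ w → (α w , ρ (↑ w)) ∈ S
    ρ↑∈saturated []      =
      resp (M.sym ε-homo) R.refl (downward full (ρ-mono R ρ-rating _))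
    ρ↑∈saturated (x ∷ w) =
      -- The unit to be absorbed is the first component of `full`.
      resp (M.trans (M.identityˡ _) (M.sym (homo [ x ] w))) R.refl
        (downward (mult full (mult letter (ρ↑∈saturated w))) (ρ↑-∷ R ρ-rating x w))
      where
      letter : (α [ x ] , ρ ｛ [ x ] ｝) ∈ S
      letter = trivial ([ x ] , M.refl , R.+-idem _)

    UpwardImprint⊆saturated : UpwardImprint ⊆ S
    UpwardImprint⊆saturated (w , α≈s , q≤) =
      resp α≈s R.refl (downward (ρ↑∈saturated w) q≤)

theorem10p4 : ∀ {m ℓm r ℓr ℓ} (A : Set) (M : Monoid m ℓm) (R : IdempotentSemiring r ℓr) →
    Finite (setoid A) → Finite (Monoid.setoid M) →
    (α : List A → Monoid.Carrier M) → IsWordMorphism A M α →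
    (ρ : Language A → IdempotentSemiring.Carrier R) → IsMultiplicativeRatingMap A R ρ →
    let open Pointed M R α ρ in
    IsΣ₁Saturated 𝒫[ Σ₁ A ] ×
    ((S : Pred (Monoid.Carrier M × IdempotentSemiring.Carrier R) ℓ) →
    IsΣ₁Saturated S → 𝒫[ Σ₁ A ] ⊆ S)
theorem10p4 A M R A-fin M-fin α α-hom ρ ρ-rating =
  𝒫-saturated A-fin M M-fin α-hom R ρ-rating ,
  λ S S-saturated →
    UpwardImprint⊆saturated A-fin M M-fin α-hom R ρ-rating S-saturated
    ∘ 𝒫⊆UpwardImprint A-fin M M-fin α-hom R ρ-rating
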